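{- Let $A_n = A_n(h,T)$ be an apex tree. Then its maximum frustration index is $l_{\max}(A_n) = \left\lfloor \frac{n}{2} \right\rfloor$.
   Context: All graphs are finite, simple and undirected. A signed graph $\Sigma=(G,\sigma)$ is a graph $G$ with a signature $\sigma:E(G)\to\{+1,-1\}$. The sign of a cycle is the product of the signs of its edges; $\Sigma$ is balanced if all its cycles are positive. The frustration index $l(\Sigma)$ is the minimum number of edges whose deletion makes $\Sigma$ balanced. $l_{\max}(G)=\max_\sigma l(G,\sigma)$ over all signatures $\sigma$ of $G$. Apex tree: $A_n(h,T)$ denotes a graph with a vertex $h$ of degree $n$ such that deleting $h$ leaves the tree $T$. Standing assumptions: all leaves of $T$ are neighbours of $h$; the graph is $2$-connected (the trivial case $A_1=K_2$ is allowed); and every vertex of degree $2$ in the graph is contained in a triangle. -}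

module Defs where

open import Data.Bool.Base using (Bool; T; not; _∧_)
open import Data.Bool.Properties using (T-∧)
open import Data.Fin.Base using (Fin; punchIn)
open import Data.Fin.Properties using (_<?_)
open import Data.Fin.Subset using (Subset; ∣_∣)
open import Data.List.Base using (List; []; _∷_; length)
open import Data.List.Relation.Unary.Unique.Propositional using (Unique)
open import Data.Nat.Base using (ℕ; suc; _≤_)
open import Data.Nat.Properties using (+-0-commutativeMonoid)
open import Data.Product.Base using (∃; ∃-syntax; _×_; proj₁)
open import Data.Sign.Base as Sign using (Sign)
open import Data.Sum.Base using (_⊎_)
open import Data.Vec.Base using (tabulate)
open import Function.Base using (_∘_)
open import Function.Bundles using (Equivalence)
open import Relation.Binary.Construct.Closure.ReflexiveTransitive using (Star; ε; _◅_)
open import Relation.Binary.PropositionalEquality using (_≡_; _≢_; refl)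
open import Relation.Nullary.Decidable using (⌊_⌋)
open import Relation.Nullary.Negation using (¬_)

open import Algebra.Properties.CommutativeMonoid.Sum +-0-commutativeMonoid using (sum)

record Graph (n : ℕ) : Set where
  field
    adj     : Fin n → Fin n → Bool
    adj-sym : ∀ u v → adj u v ≡ adj v u

  Adj : Fin n → Fin n → Set
  Adj u v = T (adj u v)

  field
    adj-irrefl : ∀ v → ¬ Adj v v

  neighbours : Fin n → Subset n
  neighbours v = tabulate (adj v)

  degree : Fin n → ℕ
  degree v = ∣ neighbours v ∣

  -- Each edge {u , v} is counted once, at its smaller endpoint.
  size : ℕ
  size = sum λ u → ∣ tabulate (λ v → ⌊ u <? v ⌋ ∧ adj u v) ∣

  Walk : Fin n → Fin n → Set
  Walk = Star Adj

  vertices : ∀ {u v} → Walk u v → List (Fin n)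
  vertices {u} ε       = u ∷ []
  vertices {u} (_ ◅ w) = u ∷ vertices w

  -- A path on at least three vertices together with an edge joining its ends.
  record Cycle : Set where
    field
      {start end} : Fin n
      path        : Walk start end
      simple      : Unique (vertices path)
      long        : 3 ≤ length (vertices path)
      closing     : Adj end start

  Connected : Set
  Connected = 1 ≤ n × (∀ u v → Walk u v)

  IsTree : Set
  IsTree = Connected × ¬ Cycle

  InTriangle : Fin n → Set
  InTriangle v = ∃[ a ] ∃[ b ] (Adj v a × Adj a b × Adj b v)

  IsK₂ : Set
  IsK₂ = n ≡ 2 × (∀ u v → u ≢ v → Adj u v)

open Graph

infixl 6 _─_ _∖_
infix  4 _⊆_

_─_ : ∀ {m} → Graph (suc m) → Fin (suc m) → Graph m
G ─ h = record
  { adj        = λ u v → adj G (punchIn h u) (punchIn h v)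
  ; adj-sym    = λ u v → adj-sym G (punchIn h u) (punchIn h v)
  ; adj-irrefl = λ v → adj-irrefl G (punchIn h v)
  }

TwoConnected : ∀ {m} → Graph (suc m) → Set
TwoConnected {m} G = 3 ≤ suc m × Connected G × (∀ v → Connected (G ─ v))

-- A set of edges of G is encoded as the spanning subgraph F ⊆ G having
-- exactly those edges.
_⊆_ : ∀ {n} → Graph n → Graph n → Set
F ⊆ G = ∀ {u v} → Adj F u v → Adj G u v

∖-adj : ∀ {n} → Graph n → Graph n → Fin n → Fin n → Bool
∖-adj G F u v = adj G u v ∧ not (adj F u v)

∖-⊆ : ∀ {n} (G F : Graph n) {u v} → T (∖-adj G F u v) → Adj G u v
∖-⊆ G F = proj₁ ∘ Equivalence.to T-∧

_∖_ : ∀ {n} → Graph n → Graph n → Graph n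
G ∖ F = record
  { adj        = ∖-adj G F
  ; adj-sym    = ∖-sym
  ; adj-irrefl = λ v e → adj-irrefl G v (∖-⊆ G F e)
  }
  where
  ∖-sym : ∀ u v → ∖-adj G F u v ≡ ∖-adj G F v u
  ∖-sym u v rewrite adj-sym G u v | adj-sym F u v = refl

record Signature {n} (G : Graph n) : Set where
  field
    sign     : ∀ {u v} → Adj G u v → Sign
    sign-sym : ∀ {u v} (e : Adj G u v) (e′ : Adj G v u) → sign e ≡ sign e′

  walkSign : ∀ {u v} → Walk G u v → Sign
  walkSign ε       = Sign.+
  walkSign (e ◅ w) = sign e Sign.* walkSign w

  cycleSign : Cycle G → Sign
  cycleSign c = sign closing Sign.* walkSign path
    where open Cycle c

  Balanced : Set
  Balanced = ∀ c → cycleSign c ≡ Sign.+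

open Signature

restrict : ∀ {n} {G : Graph n} → Signature G → (F : Graph n) → Signature (G ∖ F)
restrict {G = G} σ F = record
  { sign     = λ e → sign σ (∖-⊆ G F e)
  ; sign-sym = λ e e′ → sign-sym σ (∖-⊆ G F e) (∖-⊆ G F e′)
  }

IsMinimum : (ℕ → Set) → ℕ → Set
IsMinimum P k = P k × (∀ j → P j → k ≤ j)

IsMaximum : (ℕ → Set) → ℕ → Set
IsMaximum P k = P k × (∀ j → P j → j ≤ k)

IsFrustrationIndex : ∀ {n} {G : Graph n} → Signature G → ℕ → Set
IsFrustrationIndex {G = G} σ = IsMinimum λ k →
  ∃[ F ] (F ⊆ G × size F ≡ k × Balanced (restrict σ F))

IsMaxFrustrationIndex : ∀ {n} → Graph n → ℕ → Set
IsMaxFrustrationIndex G = IsMaximum λ k →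
  ∃ λ (σ : Signature G) → IsFrustrationIndex σ k

record IsApexTree (n : ℕ) {m} (G : Graph (suc m)) (h : Fin (suc m)) : Set where
  field
    degree-apex  : degree G h ≡ n
    tree         : IsTree (G ─ h)
    leaves       : ∀ t → degree (G ─ h) t ≡ 1 → Adj G h (punchIn h t)
    connectivity : TwoConnected G ⊎ IsK₂ G
    degree-2     : ∀ v → degree G v ≡ 2 → InTriangle G v

{-# OPTIONS --safe #-}

-- Upper bound: σ can be switched to be positive on the tree T; the edges at h
-- then fall into a positive and a negative class, and deleting the smaller
-- class leaves a graph all of whose cycles are positive.
--
-- Lower bound: in a connected graph any set of vertices can be paired up, at
-- most one being left over, by paths of which no two share an edge (if two
-- paths share an edge, reconnect them around it; this decreases the total
-- length).  Pair up the neighbours of h in T in this way.  Each path closes up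
-- through h, and making one of its two edges at h negative turns it into a
-- negative closed walk.  These ⌊ n /2⌋ walks are pairwise edge-disjoint, and a
-- deletion that balances the signature has to meet each of them.

module Submission where

open import Defs
open import Algebra.Properties.CommutativeSemigroup using (interchange; x∙yz≈y∙xz)
open import Data.Bool.Base using (Bool; true; false; T; not; _∧_; _∨_)
open import Data.Bool.Properties using (T-∧; T-∨; T?; T-irrelevant; ∨-comm)
open import Data.Fin.Base as Fin using (Fin; zero; suc; punchIn; punchOut)
open import Data.Fin.Properties as Fin using (_≟_; _<?_; punchIn-injective; punchInᵢ≢i; punchIn-punchOut; injective⇒≤)
open import Data.Fin.Subset using (∣_∣)
open import Data.List.Base as List using (List; []; _∷_; _++_; map; concat; length)
open import Data.List.Membership.Propositional using (_∈_; _∉_; find; lose)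
open import Data.List.Membership.Propositional.Properties using (∈-map⁺; ∈-map⁻; ∈-lookup; ∈-concat⁺′; ∈-concat⁻′; ∈-tabulate⁺; ∈-tabulate⁻)
open import Data.List.Membership.Setoid.Properties using (index-injective)
open import Data.List.Properties using (length-map; length-++)
open import Data.List.Relation.Binary.Permutation.Propositional using (_↭_; ↭-refl; ↭-sym; ↭-trans; prep; swap; ↭⇒↭ₛ)
open import Data.List.Relation.Binary.Permutation.Propositional.Properties using (shifts; All-resp-↭)
open import Data.List.Relation.Binary.Permutation.Setoid.Properties using (Unique-resp-↭)
open import Data.List.Relation.Unary.All as All using (All; []; _∷_)
import Data.List.Relation.Unary.All.Properties as All
open import Data.List.Relation.Unary.AllPairs as AllPairs using (AllPairs; []; _∷_)
import Data.List.Relation.Unary.AllPairs.Properties as AllPairs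
open import Data.List.Relation.Unary.Any as Any using (Any; here; there)
open import Data.List.Relation.Unary.Unique.Propositional using (Unique)
import Data.List.Relation.Unary.Unique.Propositional.Properties as Unique
open import Data.Nat.Base using (ℕ; zero; suc; _+_; _≤_; _<_; z≤n; s≤s; ⌊_/2⌋)
open import Data.Nat.Induction using (<-wellFounded)
open import Data.Nat.Properties as ℕ using (+-0-commutativeMonoid; +-commutativeSemigroup)
open import Data.Product.Base as Product using (∃; ∃-syntax; _×_; _,_; proj₁; proj₂)
open import Data.Product.Properties using (≡-dec)
open import Data.Sign.Base as Sign using (Sign)
import Data.Sign.Properties as Sign
open import Data.Sum.Base as Sum using (_⊎_; inj₁; inj₂)
open import Data.Vec.Base using (tabulate)
open import Function.Base using (_∘_; case_of_)
open import Function.Bundles using (Equivalence)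
open import Induction.WellFounded using (Acc; acc)
open import Relation.Binary.Construct.Closure.ReflexiveTransitive using (ε; _◅_; _◅◅_)
open import Relation.Binary.PropositionalEquality
open import Relation.Nullary.Decidable using (Dec; yes; no; ⌊_⌋; toWitness; fromWitness; _⊎-dec_)
open import Relation.Nullary.Negation using (¬_; contradiction)

open import Algebra.Properties.CommutativeMonoid.Sum +-0-commutativeMonoid using (sum; sum-cong-≗)

open Graph
open Signature

-- Counting edges

lookup-injective : ∀ {A : Set} {xs : List A} → Unique xs →
                   ∀ i j → List.lookup xs i ≡ List.lookup xs j → i ≡ j
lookup-injective (x∉ ∷ xs!) zero    zero    eq = refl
lookup-injective (x∉ ∷ xs!) zero    (suc j) eq = contradiction eq (All.lookup x∉ (∈-lookup j))
lookup-injective (x∉ ∷ xs!) (suc i) zero    eq = contradiction (sym eq) (All.lookup x∉ (∈-lookup i))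
lookup-injective (x∉ ∷ xs!) (suc i) (suc j) eq = cong suc (lookup-injective xs! i j eq)

-- A pigeonhole argument: sending each position of `xs` to a position of the same element in `ys` is
-- injective because `xs` has no repetition.
length-mono-⊆ : ∀ {A : Set} {xs ys : List A} → Unique xs → (∀ {x} → x ∈ xs → x ∈ ys) →
                length xs ≤ length ys
length-mono-⊆ {A} xs! xs⊆ys = injective⇒≤ λ {i} {j} eq → lookup-injective xs! i j
  (index-injective (setoid A) (xs⊆ys (∈-lookup i)) (xs⊆ys (∈-lookup j)) eq)

T-⌊⌋∧⁻ : ∀ {P : Set} (P? : Dec P) {b} → T (⌊ P? ⌋ ∧ b) → P × T b
T-⌊⌋∧⁻ P? = Product.map₁ toWitness ∘ Equivalence.to (T-∧ {⌊ P? ⌋})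

T-⌊⌋∧⁺ : ∀ {P : Set} (P? : Dec P) {b} → P → T b → T (⌊ P? ⌋ ∧ b)
T-⌊⌋∧⁺ P? p b = Equivalence.from (T-∧ {⌊ P? ⌋}) (fromWitness p , b)

-- Used to split the degree of the apex into the two classes of spokes.
∣tabulate∣-∧-not : ∀ {n} (f g : Fin n → Bool) →
                   ∣ tabulate (λ v → f v ∧ g v) ∣ + ∣ tabulate (λ v → f v ∧ not (g v)) ∣ ≡ ∣ tabulate f ∣
∣tabulate∣-∧-not {zero}  f g = refl
∣tabulate∣-∧-not {suc n} f g with f zero | g zero | ∣tabulate∣-∧-not (f ∘ suc) (g ∘ suc)
... | true  | true  | eq = cong suc eq
... | true  | false | eq = trans (ℕ.+-suc _ _) (cong suc eq)
... | false | _     | eq = eq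

∣tabulate∣-punchIn : ∀ {n} (f : Fin (suc n) → Bool) h → ¬ T (f h) →
                     ∣ tabulate (f ∘ punchIn h) ∣ ≡ ∣ tabulate f ∣
∣tabulate∣-punchIn f zero ¬fh with f zero
... | true  = contradiction _ ¬fh
... | false = refl
∣tabulate∣-punchIn {suc n} f (suc h) ¬fh with f zero | ∣tabulate∣-punchIn (f ∘ suc) h ¬fh
... | true  | eq = cong suc eq
... | false | eq = eq

smaller-half : ∀ a b → a ≤ ⌊ a + b /2⌋ ⊎ b ≤ ⌊ a + b /2⌋
smaller-half a b = Sum.map (half a b)
  (λ b≤a → subst (λ n → b ≤ ⌊ n /2⌋) (ℕ.+-comm b a) (half b a b≤a)) (ℕ.≤-total a b)
  where
  half : ∀ a b → a ≤ b → a ≤ ⌊ a + b /2⌋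
  half a b a≤b = ℕ.≤-trans (ℕ.≤-reflexive (ℕ.n≡⌊n+n/2⌋ a)) (ℕ.⌊n/2⌋-mono (ℕ.+-monoʳ-≤ a a≤b))

support : ∀ {n} → (Fin n → Bool) → List (Fin n)
support {zero}  f = []
support {suc n} f with f zero
... | true  = zero ∷ map suc (support (f ∘ suc))
... | false = map suc (support (f ∘ suc))

length-support : ∀ {n} (f : Fin n → Bool) → length (support f) ≡ ∣ tabulate f ∣
length-support {zero}  f = refl
length-support {suc n} f with f zero
... | true  = cong suc (trans (length-map suc (support (f ∘ suc))) (length-support (f ∘ suc)))
... | false = trans (length-map suc (support (f ∘ suc))) (length-support (f ∘ suc))

support-! : ∀ {n} (f : Fin n → Bool) → Unique (support f)
support-! {zero}  f = []
support-! {suc n} f with f zero | Unique.map⁺ Fin.suc-injective (support-! (f ∘ suc))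
... | true  | fs! = All.map⁺ (All.universal (λ _ ()) _) ∷ fs!
... | false | fs! = fs!

∈-support⁺ : ∀ {n} (f : Fin n → Bool) {v} → T (f v) → v ∈ support f
∈-support⁺ f {zero} fv with f zero
... | true = here refl
∈-support⁺ f {suc v} fv with f zero
... | true  = there (∈-map⁺ suc (∈-support⁺ (f ∘ suc) fv))
... | false = ∈-map⁺ suc (∈-support⁺ (f ∘ suc) fv)

∈-support⁻ : ∀ {n} (f : Fin n → Bool) {v} → v ∈ support f → T (f v)
∈-support⁻ {suc n} f v∈ with f zero in eq
∈-support⁻ {suc n} f (here refl) | true = subst T (sym eq) _
∈-support⁻ {suc n} f (there v∈)  | true with _ , w∈ , refl ← ∈-map⁻ suc v∈ = ∈-support⁻ (f ∘ suc) w∈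
∈-support⁻ {suc n} f v∈ | false with _ , w∈ , refl ← ∈-map⁻ suc v∈ = ∈-support⁻ (f ∘ suc) w∈

length-concat-tabulate : ∀ {A : Set} {n} (f : Fin n → List A) →
                         length (concat (List.tabulate f)) ≡ sum (length ∘ f)
length-concat-tabulate {n = zero}  f = refl
length-concat-tabulate {n = suc n} f = trans (length-++ (f zero))
  (cong (length (f zero) +_) (length-concat-tabulate (f ∘ suc)))

-- Edges as ascending arcs

Arc : ℕ → Set
Arc n = Fin n × Fin n

module _ {n} (G : Graph n) where

  ascends : Fin n → Fin n → Bool
  ascends u v = ⌊ u <? v ⌋ ∧ adj G u v

  ascendingFrom : Fin n → List (Arc n)
  ascendingFrom u = map (u ,_) (support (ascends u))

  -- Follows the definition of `size` row by row, so that edges can be counted by comparing lists.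
  ascending : List (Arc n)
  ascending = concat (List.tabulate ascendingFrom)

  length-ascending : length ascending ≡ size G
  length-ascending = trans (length-concat-tabulate ascendingFrom)
    (sum-cong-≗ {n} λ u → trans (length-map (u ,_) (support (ascends u))) (length-support (ascends u)))

  ∈-ascending⁺ : ∀ {u v} → u Fin.< v → Adj G u v → (u , v) ∈ ascending
  ∈-ascending⁺ {u} {v} u<v e = ∈-concat⁺′
    (∈-map⁺ (u ,_) (∈-support⁺ (ascends u) (T-⌊⌋∧⁺ (u <? v) u<v e)))
    (∈-tabulate⁺ u)

  ∈-ascending⁻ : ∀ {u v} → (u , v) ∈ ascending → u Fin.< v × Adj G u v
  ∈-ascending⁻ a∈
    with _ , a∈row , row∈ ← ∈-concat⁻′ (List.tabulate ascendingFrom) a∈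
    with u , refl ← ∈-tabulate⁻ row∈
    with v , v∈ , refl ← ∈-map⁻ (u ,_) a∈row
    = T-⌊⌋∧⁻ (u <? v) (∈-support⁻ (ascends u) v∈)

  ascending-! : Unique ascending
  ascending-! = Unique.concat⁺
    (All.tabulate⁺ λ u → Unique.map⁺ (cong proj₂) (support-! (ascends u)))
    (AllPairs.tabulate⁺ λ i≢j (a∈i , a∈j) →
      let _ , _ , eq₁ = ∈-map⁻ _ a∈i
          _ , _ , eq₂ = ∈-map⁻ _ a∈j
      in i≢j (cong proj₁ (trans (sym eq₁) eq₂)))

-- Distinctness of the underlying undirected edges.
Separate : ∀ {n} → Arc n → Arc n → Set
Separate a b = a ≢ b × a ≢ Product.swap b

orient : ∀ {n} → Arc n → Arc n
orient (u , v) = case u <? v of λ where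
  (yes _) → u , v
  (no  _) → v , u

orient-≡ : ∀ {n} (a : Arc n) → orient a ≡ a ⊎ orient a ≡ Product.swap a
orient-≡ (u , v) with u <? v
... | yes _ = inj₁ refl
... | no  _ = inj₂ refl

orient-separate : ∀ {n} {a b : Arc n} → Separate a b → orient a ≢ orient b
orient-separate {a = a} {b} (a≢b , a≢b⁻) eq with orient-≡ a | orient-≡ b
... | inj₁ p | inj₁ q = a≢b (trans (sym p) (trans eq q))
... | inj₁ p | inj₂ q = a≢b⁻ (trans (sym p) (trans eq q))
... | inj₂ p | inj₁ q = a≢b⁻ (cong Product.swap (trans (sym p) (trans eq q)))
... | inj₂ p | inj₂ q = a≢b (cong Product.swap (trans (sym p) (trans eq q)))

orient-∈ : ∀ {n} (G : Graph n) {u v} → Adj G u v → orient (u , v) ∈ ascending G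
orient-∈ G {u} {v} e with u <? v
... | yes u<v = ∈-ascending⁺ G u<v e
... | no  u≮v = ∈-ascending⁺ G
  (Fin.≤∧≢⇒< (ℕ.≮⇒≥ u≮v) λ { refl → adj-irrefl G v e })
  (subst T (adj-sym G u v) e)

-- Orienting each arc towards its larger end keeps separate arcs distinct and places them all in
-- `ascending G`.
separate-≤-size : ∀ {n} (G : Graph n) {as : List (Arc n)} →
                  All (λ (u , v) → Adj G u v) as → AllPairs Separate as → length as ≤ size G
separate-≤-size G {as} adjs seps = begin
  length as             ≡⟨ length-map orient as ⟨
  length (map orient as) ≤⟨ length-mono-⊆ (AllPairs.map⁺ (AllPairs.map orient-separate seps)) oriented ⟩
  length (ascending G)  ≡⟨ length-ascending G ⟩
  size G                ∎
  where
  open ℕ.≤-Reasoning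
  oriented : ∀ {a} → a ∈ map orient as → a ∈ ascending G
  oriented a∈ with _ , b∈ , refl ← ∈-map⁻ orient a∈ = orient-∈ G (All.lookup adjs b∈)

-- Stars

module _ {n} (h : Fin n) (s : Fin n → Bool) (¬sh : ¬ T (s h)) where

  starAdj : Fin n → Fin n → Bool
  starAdj u v = (⌊ u ≟ h ⌋ ∧ s v) ∨ (⌊ v ≟ h ⌋ ∧ s u)

  starAdj⁻ : ∀ {u v} → T (starAdj u v) → (u ≡ h × T (s v)) ⊎ (v ≡ h × T (s u))
  starAdj⁻ {u} {v} = Sum.map (T-⌊⌋∧⁻ (u ≟ h)) (T-⌊⌋∧⁻ (v ≟ h)) ∘
                     Equivalence.to (T-∨ {⌊ u ≟ h ⌋ ∧ s v})

  starAdj⁺ : ∀ {v} → T (s v) → T (starAdj h v)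
  starAdj⁺ {v} sv = Equivalence.from (T-∨ {⌊ h ≟ h ⌋ ∧ s v}) (inj₁ (T-⌊⌋∧⁺ (h ≟ h) refl sv))

  -- Serves twice: as the set of negative edges in the lower bound and as the set of deleted edges
  -- in the upper bound.
  star : Graph n
  star = record
    { adj        = starAdj
    ; adj-sym    = λ u v → ∨-comm (⌊ u ≟ h ⌋ ∧ s v) _
    ; adj-irrefl = λ v e → case starAdj⁻ {v} {v} e of λ where
        (inj₁ (refl , sh)) → ¬sh sh
        (inj₂ (refl , sh)) → ¬sh sh
    }

  size-star : size star ≤ ∣ tabulate s ∣
  size-star = begin
    size star                             ≡⟨ length-ascending star ⟨
    length (ascending star)               ≤⟨ length-mono-⊆ (ascending-! star) inside ⟩
    length (map spoke (support s))        ≡⟨ length-map spoke (support s) ⟩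
    length (support s)                    ≡⟨ length-support s ⟩
    ∣ tabulate s ∣                        ∎
    where
    open ℕ.≤-Reasoning
    spoke : Fin n → Arc n
    spoke v = orient (h , v)
    orient-yes : ∀ {u v : Fin n} → u Fin.< v → (u , v) ≡ orient (u , v)
    orient-yes {u} {v} u<v with u <? v
    ... | yes _   = refl
    ... | no  u≮v = contradiction u<v u≮v
    orient-no : ∀ {u v : Fin n} → v Fin.< u → (v , u) ≡ orient (u , v)
    orient-no {u} {v} v<u with u <? v
    ... | yes u<v = contradiction v<u (Fin.<-asym u<v)
    ... | no  _   = refl
    inside : ∀ {a} → a ∈ ascending star → a ∈ map spoke (support s)
    inside {u , v} a∈ with u<v , e ← ∈-ascending⁻ star a∈ with starAdj⁻ {u} {v} e
    ... | inj₁ (refl , sv) = subst (_∈ map spoke (support s)) (sym (orient-yes u<v)) (∈-map⁺ spoke (∈-support⁺ s sv))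
    ... | inj₂ (refl , su) = subst (_∈ map spoke (support s)) (sym (orient-no u<v)) (∈-map⁺ spoke (∈-support⁺ s su))

-- Signs of walks

module _ {n} (G : Graph n) where

  Adj-sym : ∀ {u v} → Adj G u v → Adj G v u
  Adj-sym {u} {v} = subst T (adj-sym G u v)

  rev : ∀ {u v} → Walk G u v → Walk G v u
  rev ε       = ε
  rev (e ◅ w) = rev w ◅◅ (Adj-sym e ◅ ε)

  module _ (σ : Signature G) where

    walkSign-◅◅ : ∀ {u v w} (p : Walk G u v) (q : Walk G v w) →
                  walkSign σ (p ◅◅ q) ≡ walkSign σ p Sign.* walkSign σ q
    walkSign-◅◅ ε       q = refl
    walkSign-◅◅ (e ◅ p) q = trans (cong (sign σ e Sign.*_) (walkSign-◅◅ p q))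
      (sym (Sign.*-assoc (sign σ e) _ _))

    walkSign-rev : ∀ {u v} (p : Walk G u v) → walkSign σ (rev p) ≡ walkSign σ p
    walkSign-rev ε       = refl
    walkSign-rev (e ◅ p) = begin
      walkSign σ (rev p ◅◅ (Adj-sym e ◅ ε))               ≡⟨ walkSign-◅◅ (rev p) _ ⟩
      walkSign σ (rev p) Sign.* (sign σ (Adj-sym e) Sign.* Sign.+)
        ≡⟨ cong₂ Sign._*_ (walkSign-rev p) (trans (Sign.*-identityʳ _) (sign-sym σ (Adj-sym e) e)) ⟩
      walkSign σ p Sign.* sign σ e                        ≡⟨ Sign.*-comm (walkSign σ p) _ ⟩
      sign σ e Sign.* walkSign σ p                        ∎
      where open ≡-Reasoning

    -- Prepares loop erasure: if an edge from `u` is put in front of `p`, then `q` closes the loop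
    -- and `r` is what remains. The inclusion of vertices carries the simplicity of `q` through the
    -- induction.
    splitAt : ∀ {x u v} (p : Walk G x v) → Unique (vertices G p) → u ∈ vertices G p →
              ∃ λ (q : Walk G x u) → ∃ λ (r : Walk G u v) →
              (∀ {y} → y ∈ vertices G q → y ∈ vertices G p) ×
              Unique (vertices G q) × Unique (vertices G r) ×
              walkSign σ q Sign.* walkSign σ r ≡ walkSign σ p
    splitAt ε       p! (here refl) = ε , ε , (λ y∈ → y∈) , p! , p! , refl
    splitAt (e ◅ p) p! (here refl) = ε , e ◅ p , (λ { (here eq) → here eq }) , [] ∷ [] , p! , refl
    splitAt (e ◅ p) (x∉ ∷ p!) (there u∈) =
      let q , r , q⊆p , q! , r! , eq = splitAt p p! u∈
      in e ◅ q , r , (λ { (here y≡) → here y≡ ; (there y∈) → there (q⊆p y∈) }) ,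
         All.tabulate (All.lookup x∉ ∘ q⊆p) ∷ q! , r! ,
         trans (Sign.*-assoc (sign σ e) _ _) (cong (sign σ e Sign.*_) eq)

    module _ (balanced : Balanced σ) where

      -- A `Cycle` has at least three vertices, so a loop of two edges is treated apart: in a simple
      -- graph it runs back along its first edge, and the two signs cancel.
      loop-positive : ∀ {u x} (e : Adj G u x) (q : Walk G x u) → Unique (vertices G q) →
                      sign σ e Sign.* walkSign σ q ≡ Sign.+
      loop-positive e ε                 q! = contradiction e (adj-irrefl G _)
      loop-positive e (f ◅ ε)           q! = begin
        sign σ e Sign.* (sign σ f Sign.* Sign.+) ≡⟨ cong (sign σ e Sign.*_) (Sign.*-identityʳ _) ⟩
        sign σ e Sign.* sign σ f                 ≡⟨ cong (sign σ e Sign.*_) (sign-sym σ f e) ⟩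
        sign σ e Sign.* sign σ e                 ≡⟨ Sign.s*s≡+ (sign σ e) ⟩
        Sign.+                                   ∎
        where open ≡-Reasoning
      loop-positive e q@(_ ◅ _ ◅ r) q! = balanced record
        { path    = q
        ; simple  = q!
        ; long    = s≤s (s≤s (nonempty r))
        ; closing = e
        }
        where
        nonempty : ∀ {u v} (w : Walk G u v) → 1 ≤ length (vertices G w)
        nonempty ε       = s≤s z≤n
        nonempty (_ ◅ _) = s≤s z≤n

      -- Erase loops one at a time; each contributes the sign + since it is an edge
      -- traversed back and forth or a cycle.
      straighten : ∀ {u v} (w : Walk G u v) →
                   ∃ λ (p : Walk G u v) → Unique (vertices G p) × walkSign σ p ≡ walkSign σ w
      straighten ε = ε , [] ∷ [] , refl
      straighten {u} (e ◅ w) with p , p! , eq ← straighten w with Any.any? (u ≟_) (vertices G p)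
      ... | no  u∉ = e ◅ p , All.¬Any⇒All¬ _ u∉ ∷ p! , cong (sign σ e Sign.*_) eq
      ... | yes u∈ = let q , r , _ , q! , r! , eq′ = splitAt p p! u∈ in r , r! , (begin
        walkSign σ r                                     ≡⟨ cong (Sign._* walkSign σ r) (loop-positive e q q!) ⟨
        (sign σ e Sign.* walkSign σ q) Sign.* walkSign σ r ≡⟨ Sign.*-assoc (sign σ e) _ _ ⟩
        sign σ e Sign.* (walkSign σ q Sign.* walkSign σ r) ≡⟨ cong (sign σ e Sign.*_) (trans eq′ eq) ⟩
        sign σ e Sign.* walkSign σ w                     ∎)
        where open ≡-Reasoning

      -- Straightening keeps the sign and the ends, and a path that ends where it starts is empty.
      closed-positive : ∀ {u} (w : Walk G u u) → walkSign σ w ≡ Sign.+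
      closed-positive w with straighten w
      ... | ε     , _         , eq = sym eq
      ... | _ ◅ p , (u∉ ∷ _) , _  = contradiction refl (All.lookup u∉ (last∈ p))
        where
        last∈ : ∀ {u v} (w : Walk G u v) → v ∈ vertices G w
        last∈ ε       = here refl
        last∈ (_ ◅ w) = there (last∈ w)

      -- Following `p` and returning along `q` gives a closed walk. This makes signs along walks
      -- from a root a well-defined potential.
      parallel : ∀ {u v} (p q : Walk G u v) → walkSign σ p ≡ walkSign σ q
      parallel p q = Sign.*-cancelʳ-≡ (walkSign σ q) _ _ (begin
        walkSign σ p Sign.* walkSign σ q       ≡⟨ cong (walkSign σ p Sign.*_) (walkSign-rev q) ⟨
        walkSign σ p Sign.* walkSign σ (rev q) ≡⟨ walkSign-◅◅ p (rev q) ⟨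
        walkSign σ (p ◅◅ rev q)                ≡⟨ closed-positive (p ◅◅ rev q) ⟩
        Sign.+                                 ≡⟨ Sign.s*s≡+ (walkSign σ q) ⟨
        walkSign σ q Sign.* walkSign σ q       ∎)
        where open ≡-Reasoning

    module _ (φ : Fin n → Sign) (switch : ∀ {u v} (e : Adj G u v) → sign σ e ≡ φ u Sign.* φ v) where

      -- The product telescopes, since every inner vertex contributes the square of its sign.
      walkSign-potential : ∀ {u v} (w : Walk G u v) → walkSign σ w ≡ φ u Sign.* φ v
      walkSign-potential {u} ε = sym (Sign.s*s≡+ (φ u))
      walkSign-potential {u} {v} (_◅_ {j = x} e w) = begin
        sign σ e Sign.* walkSign σ w                ≡⟨ cong₂ Sign._*_ (switch e) (walkSign-potential w) ⟩
        (φ u Sign.* φ x) Sign.* (φ x Sign.* φ v)    ≡⟨ Sign.*-assoc (φ u) (φ x) _ ⟩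
        φ u Sign.* (φ x Sign.* (φ x Sign.* φ v))    ≡⟨ cong (φ u Sign.*_) (Sign.*-assoc (φ x) (φ x) _) ⟨
        φ u Sign.* ((φ x Sign.* φ x) Sign.* φ v)    ≡⟨ cong (λ s → φ u Sign.* (s Sign.* φ v)) (Sign.s*s≡+ (φ x)) ⟩
        φ u Sign.* φ v                              ∎
        where open ≡-Reasoning

      -- The easy half of Harary's criterion: a signature that can be switched to all positive is
      -- balanced.
      potential-balanced : Balanced σ
      potential-balanced c = begin
        sign σ closing Sign.* walkSign σ path            ≡⟨ cong₂ Sign._*_ (switch closing) (walkSign-potential path) ⟩
        (φ end Sign.* φ start) Sign.* (φ start Sign.* φ end) ≡⟨ cong (Sign._* (φ start Sign.* φ end)) (Sign.*-comm (φ end) _) ⟩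
        (φ start Sign.* φ end) Sign.* (φ start Sign.* φ end) ≡⟨ Sign.s*s≡+ (φ start Sign.* φ end) ⟩
        Sign.+                                           ∎
        where
        open ≡-Reasoning
        open Cycle c

-- Routes

module _ {n} (G : Graph n) where

  arcs : ∀ {u v} → Walk G u v → List (Arc n)
  arcs ε                     = []
  arcs {u} (_◅_ {j = x} e w) = (u , x) ∷ arcs w

  steps : ∀ {u v} → Walk G u v → ℕ
  steps = length ∘ arcs

  steps-◅◅ : ∀ {u v w} (p : Walk G u v) (q : Walk G v w) → steps (p ◅◅ q) ≡ steps p + steps q
  steps-◅◅ ε       q = refl
  steps-◅◅ (e ◅ p) q = cong suc (steps-◅◅ p q)

  steps-rev : ∀ {u v} (p : Walk G u v) → steps (rev G p) ≡ steps p
  steps-rev ε       = refl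
  steps-rev (e ◅ p) = trans (steps-◅◅ (rev G p) _) (trans (ℕ.+-comm _ 1) (cong suc (steps-rev p)))

  -- The arc `(x , y)` belongs to neither part. This missing step is what makes an exchange shorten
  -- the routes.
  cutAt : ∀ {u v x y} (w : Walk G u v) → (x , y) ∈ arcs w →
          ∃ λ (p : Walk G u x) → ∃ λ (q : Walk G y v) → suc (steps p + steps q) ≡ steps w
  cutAt (e ◅ w) (here refl) = ε , w , refl
  cutAt (e ◅ w) (there a∈)  = let p , q , eq = cutAt w a∈ in e ◅ p , q , cong suc eq

  record Route : Set where
    constructor route
    field
      {source target} : Fin n
      walk            : Walk G source target

  open Route

  ends : List Route → List (Fin n)
  ends []       = []
  ends (r ∷ rs) = source r ∷ target r ∷ ends rs

  total : List Route → ℕ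
  total []       = 0
  total (r ∷ rs) = steps (walk r) + total rs

  -- A common edge counts whether or not the two routes traverse it in the same direction.
  Meets : Route → Route → Set
  Meets r s = Any (λ a → a ∈ arcs (walk s) ⊎ Product.swap a ∈ arcs (walk s)) (arcs (walk r))

  meets? : ∀ r s → Dec (Meets r s)
  meets? r s = Any.any? (λ a → (a ∈? arcs (walk s)) ⊎-dec (Product.swap a ∈? arcs (walk s))) (arcs (walk r))
    where open import Data.List.Membership.DecPropositional (≡-dec (_≟_ {n}) _≟_) using (_∈?_)

  -- One step of the descent. The ends are kept only as a multiset, because reconnecting routes
  -- changes which vertices are paired.
  record _↝_ (rs ss : List Route) : Set where
    field
      ends-↭  : ends ss ↭ ends rs
      length≡ : length ss ≡ length rs
      total<  : total ss < total rs

  open _↝_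

  -- Length count for an exchange: `P` and `Q` are the old lengths, each consisting of two parts and
  -- the shared edge, while the new routes use the four parts alone.
  recombine : ∀ p p′ q q′ t {P Q} → suc (p + p′) ≡ P → suc (q + q′) ≡ Q →
              (p + q) + ((p′ + q′) + t) < P + (Q + t)
  recombine p p′ q q′ t refl refl = begin-strict
    (p + q) + ((p′ + q′) + t)     ≡⟨ ℕ.+-assoc (p + q) _ t ⟨
    ((p + q) + (p′ + q′)) + t     ≡⟨ cong (_+ t) (interchange +-commutativeSemigroup p q p′ q′) ⟩
    ((p + p′) + (q + q′)) + t     ≡⟨ ℕ.+-assoc (p + p′) _ t ⟩
    (p + p′) + ((q + q′) + t)     <⟨ ℕ.+-mono-<-≤ (ℕ.n<1+n (p + p′)) (ℕ.n≤1+n _) ⟩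
    suc (p + p′) + (suc (q + q′) + t) ∎
    where open ℕ.≤-Reasoning

  -- Two routes through a common edge can be reconnected so as to skip it.
  exchange : ∀ {r s} → Meets r s → ∀ rs → ∃ λ ss → (r ∷ s ∷ rs) ↝ ss
  exchange {r} {s} m rs with _ , a∈r , a∈s ← find m with p , p′ , P ← cutAt (walk r) a∈r | a∈s
  -- Same direction: the initial parts both end at the first vertex of the edge and are joined
  -- there, the final parts at the second.
  ... | inj₁ a∈ = let q , q′ , Q = cutAt (walk s) a∈ in
    route (p ◅◅ rev G q) ∷ route (rev G p′ ◅◅ q′) ∷ rs , record
      { ends-↭  = prep _ (swap _ _ ↭-refl)
      ; length≡ = refl
      ; total<  = subst₂ (λ i j → i + (j + total rs) < total (r ∷ s ∷ rs))
          (sym (trans (steps-◅◅ p (rev G q)) (cong (steps p +_) (steps-rev q))))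
          (sym (trans (steps-◅◅ (rev G p′) q′) (cong (_+ steps q′) (steps-rev p′))))
          (recombine (steps p) (steps p′) (steps q) (steps q′) (total rs) P Q)
      }
  -- Opposite directions: each initial part ends where the final part of the other route begins.
  ... | inj₂ a∈ = let q , q′ , Q = cutAt (walk s) a∈ in
    route (p ◅◅ q′) ∷ route (q ◅◅ p′) ∷ rs , record
      { ends-↭  = prep _ (↭-trans (prep _ (swap _ _ ↭-refl)) (↭-trans (swap _ _ ↭-refl) (prep _ (swap _ _ ↭-refl))))
      ; length≡ = refl
      ; total<  = subst₂ (λ i j → i + (j + total rs) < total (r ∷ s ∷ rs))
          (sym (steps-◅◅ p q′))
          (sym (trans (steps-◅◅ q p′) (ℕ.+-comm (steps q) _)))
          (recombine (steps p) (steps p′) (steps q′) (steps q) (total rs) P (trans (cong suc (ℕ.+-comm (steps q′) _)) Q))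
      }

  -- Routes before the one met by `r` are carried along unchanged; they move in front of `r`, which
  -- costs a permutation of the ends.
  shorten : ∀ r rs → Any (Meets r) rs → ∃ λ ss → (r ∷ rs) ↝ ss
  shorten r (s ∷ rs) (here m)  = exchange m rs
  shorten r (s ∷ rs) (there m) with ss , r∷rs↝ss ← shorten r rs m = s ∷ ss , record
    { ends-↭  = ↭-trans (prep _ (prep _ (ends-↭ r∷rs↝ss)))
        (shifts (source s ∷ target s ∷ []) (source r ∷ target r ∷ []))
    ; length≡ = cong suc (length≡ r∷rs↝ss)
    ; total<  = ℕ.<-≤-trans (ℕ.+-monoʳ-< (steps (walk s)) (total< r∷rs↝ss))
        (ℕ.≤-reflexive (x∙yz≈y∙xz +-commutativeSemigroup (steps (walk s)) (steps (walk r)) (total rs)))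
    }

  Disentangled : List Route → Set
  Disentangled = AllPairs λ r s → ¬ Meets r s

  disentangled? : ∀ rs → Disentangled rs ⊎ ∃ λ ss → rs ↝ ss
  disentangled? []       = inj₁ []
  disentangled? (r ∷ rs) with Any.any? (meets? r) rs | disentangled? rs
  ... | yes m | _       = inj₂ (shorten r rs m)
  ... | no ¬m | inj₁ rs# = inj₁ (All.¬Any⇒All¬ rs ¬m ∷ rs#)
  ... | no ¬m | inj₂ (ss , rs↝ss) = inj₂ (r ∷ ss , record
    { ends-↭  = prep _ (prep _ (ends-↭ rs↝ss))
    ; length≡ = cong suc (length≡ rs↝ss)
    ; total<  = ℕ.+-monoʳ-< (steps (walk r)) (total< rs↝ss)
    })

  -- Well-founded descent on the total length; when no move is left, the routes are pairwise
  -- edge-disjoint.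
  disentangle : ∀ rs → ∃ λ ss → ends ss ↭ ends rs × length ss ≡ length rs × Disentangled ss
  disentangle rs = go rs (<-wellFounded (total rs))
    where
    go : ∀ rs → Acc _<_ (total rs) → ∃ λ ss → ends ss ↭ ends rs × length ss ≡ length rs × Disentangled ss
    go rs (acc rec) with disentangled? rs
    ... | inj₁ rs#          = rs , ↭-refl , refl , rs#
    ... | inj₂ (ss , rs↝ss) with ts , ts↭ , len , ts# ← go ss (rec (total< rs↝ss)) =
      ts , ↭-trans ts↭ (ends-↭ rs↝ss) , trans len (length≡ rs↝ss) , ts#

  module _ (connect : ∀ u v → Walk G u v) where

    pairUp : List (Fin n) → List Route
    pairUp (u ∷ v ∷ vs) = route (connect u v) ∷ pairUp vs
    -- A last vertex without a partner is dropped; this accounts for the rounding down in the bound.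
    pairUp _            = []

    length-pairUp : ∀ vs → length (pairUp vs) ≡ ⌊ length vs /2⌋
    length-pairUp []           = refl
    length-pairUp (_ ∷ [])     = refl
    length-pairUp (_ ∷ _ ∷ vs) = cong suc (length-pairUp vs)

    ends-pairUp-All : ∀ {P : Fin n → Set} {vs} → All P vs → All P (ends (pairUp vs))
    ends-pairUp-All []             = []
    ends-pairUp-All (_ ∷ [])       = []
    ends-pairUp-All (pu ∷ pv ∷ ps) = pu ∷ pv ∷ ends-pairUp-All ps

    ends-pairUp-! : ∀ {vs} → Unique vs → Unique (ends (pairUp vs))
    ends-pairUp-! []                        = []
    ends-pairUp-! (_ ∷ [])                  = []
    ends-pairUp-! ((u≢v ∷ u∉) ∷ v∉ ∷ vs!) =
      (u≢v ∷ ends-pairUp-All u∉) ∷ ends-pairUp-All v∉ ∷ ends-pairUp-! vs!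

  source∈ends : ∀ {r rs} → r ∈ rs → source r ∈ ends rs
  source∈ends (here refl) = here refl
  source∈ends (there r∈)  = there (there (source∈ends r∈))

  target∈ends : ∀ {r rs} → r ∈ rs → target r ∈ ends rs
  target∈ends (here refl) = there (here refl)
  target∈ends (there r∈)  = there (there (target∈ends r∈))

  -- Covers `r` and `s` equal as well. It ensures that the spoke at a target is not the negative
  -- spoke of any route.
  target≢source : ∀ {r s rs} → Unique (ends rs) → r ∈ rs → s ∈ rs → target r ≢ source s
  target≢source ((≢t ∷ _) ∷ _)     (here refl) (here refl) eq = ≢t (sym eq)
  target≢source (_ ∷ t∉ ∷ _)       (here refl) (there s∈)  eq = All.lookup t∉ (source∈ends s∈) eq
  target≢source ((_ ∷ s∉) ∷ _)     (there r∈)  (here refl) eq = All.lookup s∉ (target∈ends r∈) (sym eq)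
  target≢source (_ ∷ _ ∷ rs!)      (there r∈)  (there s∈)  eq = target≢source rs! r∈ s∈ eq

  endpoints : Route → List (Fin n)
  endpoints r = source r ∷ target r ∷ []

  Apart : Route → Route → Set
  Apart r s = ∀ {t} → t ∈ endpoints r → t ∉ endpoints s

  ends-apart : ∀ {rs} → Unique (ends rs) → AllPairs Apart rs
  ends-apart {[]}     _                        = []
  ends-apart {r ∷ rs} ((_ ∷ s∉) ∷ (t∉ ∷ rs!)) = All.tabulate apart ∷ ends-apart rs!
    where
    endpoint∈ : ∀ {s t} → s ∈ rs → t ∈ endpoints s → t ∈ ends rs
    endpoint∈ s∈ (here refl)         = source∈ends s∈
    endpoint∈ s∈ (there (here refl)) = target∈ends s∈
    apart : ∀ {s} → s ∈ rs → Apart r s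
    apart s∈ (here refl)         t∈ = All.lookup s∉ (endpoint∈ s∈ t∈) refl
    apart s∈ (there (here refl)) t∈ = All.lookup t∉ (endpoint∈ s∈ t∈) refl

-- Representatives, deletion of edges, and signs

-- A system of representatives: the relation between elements passes to the picks. The inner
-- recursion also records that each later pick comes from some later element, so that the head can
-- be compared with it.
choose : ∀ {A B : Set} {P : A → B → Set} {R : A → A → Set} {Q : B → Set} {S : B → B → Set} {xs} →
         (∀ {x y a b} → R x y → P x a → P y b → S a b) →
         All (λ x → ∃ λ a → P x a × Q a) xs → AllPairs R xs →
         ∃ λ as → length as ≡ length xs × All Q as × AllPairs S as
choose {A} {B} {P} {R} {Q} {S} separate chosen related =
  let as , len , qs , ss , _ = go chosen related in as , len , qs , ss
  where
  go : ∀ {xs} → All (λ x → ∃ λ a → P x a × Q a) xs → AllPairs R xs →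
       ∃ λ as → length as ≡ length xs × All Q as × AllPairs S as ×
                All (λ a → Any (λ x → P x a) xs) as
  go []                   []         = [] , refl , [] , [] , []
  go ((a , pa , qa) ∷ cs) (rx ∷ rxs) =
    let as , len , qs , ss , ps = go cs rxs
    in a ∷ as , cong suc len , qa ∷ qs ,
       All.map (λ any → let _ , y∈ , pb = find any in separate (All.lookup rx y∈) pa pb) ps ∷ ss ,
       here pa ∷ All.map there ps

∖-intro : ∀ {n} (G F : Graph n) {u v} → Adj G u v → ¬ Adj F u v → Adj (G ∖ F) u v
∖-intro G F {u} {v} e ¬f = Equivalence.from (T-∧ {adj G u v}) (e , T-not (adj F u v) ¬f)
  where
  T-not : ∀ b → ¬ T b → T (not b)
  T-not true  ¬b = ¬b _
  T-not false _  = _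

∖-∉ : ∀ {n} (G F : Graph n) {u v} → Adj (G ∖ F) u v → ¬ Adj F u v
∖-∉ G F {u} {v} e f with adj G u v | adj F u v
∖-∉ G F {u} {v} () f | true  | true
∖-∉ G F {u} {v} () f | false | true

toSign : Bool → Sign
toSign true  = Sign.-
toSign false = Sign.+

toSign-T : ∀ {b} → T b → toSign b ≡ Sign.-
toSign-T {true} _ = refl

toSign-¬T : ∀ {b} → ¬ T b → toSign b ≡ Sign.+
toSign-¬T {true}  ¬b = contradiction _ ¬b
toSign-¬T {false} _  = refl

-- Lower bound

module _ {m} (G : Graph (suc m)) (h : Fin (suc m)) {rs : List (Route (G ─ h))}
         (rs! : Unique (ends (G ─ h) rs))
         (neighbours : All (λ t → Adj G h (punchIn h t)) (ends (G ─ h) rs))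
         (rs# : Disentangled (G ─ h) rs)
         where

  private
    open Route

    H = G ─ h

    ι : Fin m → Fin (suc m)
    ι = punchIn h

    ι-injective : ∀ {x y} → ι x ≡ ι y → x ≡ y
    ι-injective = punchIn-injective h _ _

    h≢ι : ∀ {x} → h ≢ ι x
    h≢ι eq = punchInᵢ≢i h _ (sym eq)

  isSource? : ∀ v → Dec (Any (λ r → v ≡ ι (source r)) rs)
  isSource? v = Any.any? (λ r → v ≟ ι (source r)) rs

  isSource : Fin (suc m) → Bool
  isSource v = ⌊ isSource? v ⌋

  ¬source-h : ¬ T (isSource h)
  ¬source-h h∈ with _ , _ , eq ← find (toWitness {a? = isSource? h} h∈) = punchInᵢ≢i h _ (sym eq)

  -- One negative edge per route.
  negatives : Graph (suc m)
  negatives = star h isSource ¬source-h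

  -- Each route has a negative spoke at its source and a positive one at its target, and the edges
  -- off the apex are positive; so closing a route through `h` gives a negative walk.
  alternating : Signature G
  alternating = record
    { sign     = λ {u} {v} _ → toSign (adj negatives u v)
    ; sign-sym = λ {u} {v} _ _ → cong toSign (adj-sym negatives u v)
    }

  -- The edges of the closed walk formed by `r` and the apex, each in one fixed direction.
  data On (r : Route H) : Arc (suc m) → Set where
    spoke : ∀ {t} → t ∈ endpoints H r → On r (h , ι t)
    link  : ∀ {x y} → (x , y) ∈ arcs H (walk r) → On r (ι x , ι y)

  -- Two spokes differ in their ends in the tree, two links because the routes do not meet, and a
  -- spoke differs from a link because only the spoke contains `h`.
  on-separate : ∀ {r s a b} → Apart H r s × ¬ Meets H r s → On r a → On s b → Separate a b
  on-separate {r} {s} (apart , ¬meet) = λ where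
    (spoke t∈) (spoke t′∈) → (λ eq → apart t∈ (subst (_∈ endpoints H s) (sym (ι-injective (cong proj₂ eq))) t′∈))
                           , (λ eq → h≢ι (cong proj₁ eq))
    (spoke t∈) (link b∈)   → (λ eq → h≢ι (cong proj₁ eq)) , (λ eq → h≢ι (cong proj₁ eq))
    (link a∈)  (spoke t∈)  → (λ eq → h≢ι (sym (cong proj₁ eq))) , (λ eq → h≢ι (sym (cong proj₂ eq)))
    (link a∈)  (link b∈)   →
        (λ eq → ¬meet (lose a∈ (inj₁ (subst (_∈ arcs H (walk s))
          (cong₂ _,_ (sym (ι-injective (cong proj₁ eq))) (sym (ι-injective (cong proj₂ eq)))) b∈))))
      , (λ eq → ¬meet (lose a∈ (inj₂ (subst (_∈ arcs H (walk s))
          (cong₂ _,_ (sym (ι-injective (cong proj₂ eq))) (sym (ι-injective (cong proj₁ eq)))) b∈))))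

  ¬negative-link : ∀ {x y} → ¬ Adj negatives (ι x) (ι y)
  ¬negative-link {x} {y} e with starAdj⁻ h isSource ¬source-h {ι x} {ι y} e
  ... | inj₁ (eq , _) = punchInᵢ≢i h _ eq
  ... | inj₂ (eq , _) = punchInᵢ≢i h _ eq

  negative-source : ∀ {r} → r ∈ rs → Adj negatives h (ι (source r))
  negative-source r∈ = starAdj⁺ h isSource ¬source-h (fromWitness (lose r∈ refl))

  ¬negative-target : ∀ {r} → r ∈ rs → ¬ Adj negatives (ι (target r)) h
  ¬negative-target {r} r∈ e with starAdj⁻ h isSource ¬source-h {ι (target r)} {h} e
  ... | inj₁ (eq , _) = punchInᵢ≢i h _ eq
  ... | inj₂ (_ , t∈) with _ , s∈ , eq ← find (toWitness {a? = isSource? (ι (target r))} t∈) =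
    target≢source H rs! r∈ s∈ (punchIn-injective h _ _ eq)

  module _ (F : Graph (suc m)) (balanced : Balanced (restrict alternating F)) where

    -- A route missed by `F` survives the deletion, and it stays positive since no link is negative.
    avoid : ∀ {u v} (w : Walk H u v) → All (λ (x , y) → ¬ Adj F (ι x) (ι y)) (arcs H w) →
            ∃ λ (w′ : Walk (G ∖ F) (ι u) (ι v)) → walkSign (restrict alternating F) w′ ≡ Sign.+
    avoid ε       []        = ε , refl
    avoid (e ◅ w) (¬f ∷ ¬fs) = let w′ , eq = avoid w ¬fs in
      ∖-intro G F e ¬f ◅ w′ , cong₂ Sign._*_ (toSign-¬T ¬negative-link) eq

    -- Otherwise the whole closed walk through `h` survives with sign minus. It may repeat vertices,
    -- so the contradiction comes from the positivity of all closed walks rather than of cycles.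
    hit : ∀ {r} → r ∈ rs → ∃ λ a → On r a × Adj F (proj₁ a) (proj₂ a)
    hit {r} r∈
      with T? (adj F h (ι (source r))) | T? (adj F h (ι (target r)))
         | Any.any? (λ (x , y) → T? (adj F (ι x) (ι y))) (arcs H (walk r))
    ... | yes f | _     | _     = _ , spoke (here refl) , f
    ... | no _  | yes f | _     = _ , spoke (there (here refl)) , f
    ... | no _  | no _  | yes f = let _ , a∈ , f = find f in _ , link a∈ , f
    ... | no ¬s | no ¬t | no ¬w = contradiction (trans (sym closed-negative) closed-sign) λ ()
      where
      σF = restrict alternating F
      along = avoid (walk r) (All.¬Any⇒All¬ _ ¬w)
      out : Adj (G ∖ F) h (ι (source r))
      out = ∖-intro G F (All.lookup neighbours (source∈ends H r∈)) ¬s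
      back : Adj (G ∖ F) (ι (target r)) h
      back = Adj-sym (G ∖ F) (∖-intro G F (All.lookup neighbours (target∈ends H r∈)) ¬t)
      closed : Walk (G ∖ F) h h
      closed = out ◅ (proj₁ along ◅◅ (back ◅ ε))
      closed-sign : walkSign σF closed ≡ Sign.+
      closed-sign = closed-positive (G ∖ F) σF balanced closed
      closed-negative : walkSign σF closed ≡ Sign.-
      closed-negative = cong₂ Sign._*_ (toSign-T (negative-source r∈))
        (trans (walkSign-◅◅ (G ∖ F) σF (proj₁ along) _)
          (cong₂ Sign._*_ (proj₂ along)
            (cong (Sign._* Sign.+) (toSign-¬T (¬negative-target r∈)))))

    deletion-≥ : length rs ≤ size F
    deletion-≥ =
      let as , len , adjs , seps = choose on-separate (All.tabulate hit)
                                     (AllPairs.zip (ends-apart H rs! , rs#))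
      in subst (_≤ size F) len (separate-≤-size F adjs seps)

-- Upper bound

module _ {m} (G : Graph (suc m)) (h : Fin (suc m)) (tree : IsTree (G ─ h)) (σ : Signature G) where

  private
    H = G ─ h

    τ : Signature H
    τ = record { sign = sign σ ; sign-sym = sign-sym σ }

    connect : ∀ u v → Walk H u v
    connect = proj₂ (proj₁ tree)

    root : Fin m
    root = Fin.fromℕ< (proj₁ (proj₁ tree))

  θ : Fin m → Sign
  θ t = walkSign τ (connect root t)

  -- A tree has no cycles, so it is balanced vacuously; hence the walk to `x` extended by `e` has
  -- the sign of the chosen walk to `y`.
  θ-switch : ∀ {x y} (e : Adj H x y) → sign τ e ≡ θ x Sign.* θ y
  θ-switch {x} {y} e = Sign.*-cancelˡ-≡ (θ x) _ _ (begin
    θ x Sign.* sign τ e               ≡⟨ cong (θ x Sign.*_) (Sign.*-identityʳ _) ⟨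
    θ x Sign.* (sign τ e Sign.* Sign.+) ≡⟨ walkSign-◅◅ H τ (connect root x) (e ◅ ε) ⟨
    walkSign τ (connect root x ◅◅ (e ◅ ε)) ≡⟨ parallel H τ (λ c → contradiction c (proj₂ tree))
                                           (connect root x ◅◅ (e ◅ ε)) (connect root y) ⟩
    θ y                               ≡⟨ cong (Sign._* θ y) (Sign.s*s≡+ (θ x)) ⟨
    (θ x Sign.* θ x) Sign.* θ y       ≡⟨ Sign.*-assoc (θ x) (θ x) _ ⟩
    θ x Sign.* (θ x Sign.* θ y)       ∎)
    where open ≡-Reasoning

  -- The switching function: the edges at h that respect it are those of sign s
  -- after the tree has been made positive.
  φ : Sign → Fin (suc m) → Sign
  φ s v with h ≟ v
  ... | yes _  = s
  ... | no h≢v = θ (punchOut h≢v)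

  φ-independent : ∀ s s′ {v} → h ≢ v → φ s v ≡ φ s′ v
  φ-independent s s′ {v} h≢v with h ≟ v
  ... | yes h≡v = contradiction h≡v h≢v
  ... | no _    = refl

  φ-apex : ∀ s → φ s h ≡ s
  φ-apex s with h ≟ h
  ... | yes _  = refl
  ... | no h≢h = contradiction refl h≢h

  switch-links : ∀ s {u v} → h ≢ u → h ≢ v → (e : Adj G u v) → sign σ e ≡ φ s u Sign.* φ s v
  switch-links s {u} {v} h≢u h≢v e with h ≟ u | h ≟ v
  ... | yes h≡u | _       = contradiction h≡u h≢u
  ... | no _    | yes h≡v = contradiction h≡v h≢v
  ... | no h≢u  | no h≢v  = along (punchIn-punchOut h≢u) (punchIn-punchOut h≢v) e
    where
    along : ∀ {u v x y} → punchIn h x ≡ u → punchIn h y ≡ v → (e : Adj G u v) → sign σ e ≡ θ x Sign.* θ y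
    along refl refl = θ-switch

  apex-≢ : ∀ {v} → Adj G h v → h ≢ v
  apex-≢ e refl = adj-irrefl G h e

  module _ (s : Sign) (q : Fin (suc m) → Bool)
           (keep : ∀ {v} (e : Adj G h v) → ¬ T (q v) → sign σ e ≡ s Sign.* φ Sign.+ v) where

    -- Intersecting `q` with the neighbours of `h` keeps the star inside `G` and excludes `h`
    -- itself.
    deleted : Fin (suc m) → Bool
    deleted v = adj G h v ∧ q v

    ¬deleted-h : ¬ T (deleted h)
    ¬deleted-h = adj-irrefl G h ∘ proj₁ ∘ Equivalence.to (T-∧ {adj G h h})

    deletion : Graph (suc m)
    deletion = star h deleted ¬deleted-h

    deletion-⊆ : deletion ⊆ G
    deletion-⊆ {u} {v} e with starAdj⁻ h deleted ¬deleted-h {u} {v} e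
    ... | inj₁ (refl , d) = proj₁ (Equivalence.to (T-∧ {adj G h v}) d)
    ... | inj₂ (refl , d) = Adj-sym G (proj₁ (Equivalence.to (T-∧ {adj G h u}) d))

    switch-spoke : ∀ {v} (e : Adj G h v) → ¬ Adj deletion h v → sign σ e ≡ φ s h Sign.* φ s v
    switch-spoke {v} e ¬d = begin
      sign σ e              ≡⟨ keep e (λ qv → ¬d (starAdj⁺ h deleted ¬deleted-h
                                 (Equivalence.from (T-∧ {adj G h v}) (e , qv)))) ⟩
      s Sign.* φ Sign.+ v   ≡⟨ cong₂ Sign._*_ (sym (φ-apex s)) (φ-independent Sign.+ s (apex-≢ e)) ⟩
      φ s h Sign.* φ s v    ∎
      where open ≡-Reasoning

    switch : ∀ {u v} (e : Adj (G ∖ deletion) u v) →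
             sign (restrict σ deletion) e ≡ φ s u Sign.* φ s v
    switch {u} {v} e = cases (h ≟ u) (h ≟ v)
      where
      e′ : Adj G u v
      e′ = ∖-⊆ G deletion e
      cases : Dec (h ≡ u) → Dec (h ≡ v) → sign σ e′ ≡ φ s u Sign.* φ s v
      cases (no h≢u)   (no h≢v)   = switch-links s h≢u h≢v e′
      cases (yes refl) _          = switch-spoke e′ (∖-∉ G deletion e)
      cases (no _)     (yes refl) = begin
        sign σ e′                 ≡⟨ sign-sym σ e′ (Adj-sym G e′) ⟩
        sign σ (Adj-sym G e′)     ≡⟨ switch-spoke (Adj-sym G e′) (∖-∉ G deletion (Adj-sym (G ∖ deletion) e)) ⟩
        φ s h Sign.* φ s u        ≡⟨ Sign.*-comm (φ s h) _ ⟩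
        φ s u Sign.* φ s h        ∎
        where open ≡-Reasoning

    deletion-balanced : Balanced (restrict σ deletion)
    deletion-balanced = potential-balanced (G ∖ deletion) (restrict σ deletion) (φ s) switch

  isNegative : Sign → Bool
  isNegative s = ⌊ s Sign.≟ Sign.- ⌋

  -- Marks the spokes that are negative after switching by `φ Sign.+`, that is, with the tree made
  -- positive and the apex left unswitched.
  dissents : Fin (suc m) → Bool
  dissents v with T? (adj G h v)
  ... | yes e = isNegative (sign σ e Sign.* φ Sign.+ v)
  -- An arbitrary value: both classes are later intersected with the neighbours of `h`.
  ... | no  _ = false

  dissents-≡ : ∀ {v} (e : Adj G h v) → dissents v ≡ isNegative (sign σ e Sign.* φ Sign.+ v)
  dissents-≡ {v} e with T? (adj G h v)
  ... | yes e′ = cong (λ e → isNegative (sign σ e Sign.* φ Sign.+ v)) (T-irrelevant e′ e)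
  ... | no ¬e  = contradiction e ¬e

  concord : ∀ s t → ¬ T (isNegative (s Sign.* t)) → s ≡ Sign.+ Sign.* t
  concord Sign.+ Sign.+ _ = refl
  concord Sign.+ Sign.- ¬neg = contradiction _ ¬neg
  concord Sign.- Sign.+ ¬neg = contradiction _ ¬neg
  concord Sign.- Sign.- _ = refl

  discord : ∀ s t → ¬ T (not (isNegative (s Sign.* t))) → s ≡ Sign.- Sign.* t
  discord Sign.+ Sign.+ ¬pos = contradiction _ ¬pos
  discord Sign.+ Sign.- _ = refl
  discord Sign.- Sign.+ _ = refl
  discord Sign.- Sign.- ¬pos = contradiction _ ¬pos

  -- Giving `h` the sign plus requires deleting the dissenting spokes, giving it minus the other
  -- ones. The two classes add up to the degree, so one of them has at most half of it.
  small-deletion : ∃[ F ] (F ⊆ G × Balanced (restrict σ F) × size F ≤ ⌊ degree G h /2⌋)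
  small-deletion = subst (λ n → ∃[ F ] (F ⊆ G × Balanced (restrict σ F) × size F ≤ ⌊ n /2⌋))
    (∣tabulate∣-∧-not (adj G h) dissents)
    (Sum.[_,_]′
      (build Sign.+ dissents (λ {v} e ¬d → concord _ _ (subst (λ b → ¬ T b) (dissents-≡ e) ¬d)))
      (build Sign.- (not ∘ dissents) (λ {v} e ¬d → discord _ _ (subst (λ b → ¬ T (not b)) (dissents-≡ e) ¬d)))
      (smaller-half _ _))
    where
    build : ∀ s q (keep : ∀ {v} (e : Adj G h v) → ¬ T (q v) → sign σ e ≡ s Sign.* φ Sign.+ v) {k} →
            ∣ tabulate (λ v → adj G h v ∧ q v) ∣ ≤ k →
            ∃[ F ] (F ⊆ G × Balanced (restrict σ F) × size F ≤ k)
    build s q keep ≤k = deletion s q keep , (λ {u} {v} → deletion-⊆ s q keep {u} {v}) , deletion-balanced s q keep ,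
      ℕ.≤-trans (size-star h (deleted s q keep) (¬deleted-h s q keep)) ≤k

-- The two bounds combined

-- The routes, and with them the signature, are fixed before `F`; they pair up the neighbours of `h`
-- inside `G ─ h`.
stubborn-signature : ∀ {m} (G : Graph (suc m)) (h : Fin (suc m)) → (∀ u v → Walk (G ─ h) u v) →
                     ∃ λ (σ : Signature G) → ∀ F → Balanced (restrict σ F) → ⌊ degree G h /2⌋ ≤ size F
stubborn-signature {m} G h connect
  with rs , ends↭ , len , rs# ← disentangle (G ─ h) (pairUp (G ─ h) connect (support (adj G h ∘ punchIn h)))
  = alternating G h rs! nbrs rs# , λ F balanced →
    subst (_≤ size F) count (deletion-≥ G h rs! nbrs rs# F balanced)
  where
  spokes : Fin m → Bool
  spokes = adj G h ∘ punchIn h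
  rs! : Unique (ends (G ─ h) rs)
  rs! = Unique-resp-↭ (setoid (Fin m)) (↭⇒↭ₛ (↭-sym ends↭))
          (ends-pairUp-! (G ─ h) connect (support-! spokes))
  nbrs : All (λ t → Adj G h (punchIn h t)) (ends (G ─ h) rs)
  nbrs = All-resp-↭ (↭-sym ends↭)
           (ends-pairUp-All (G ─ h) connect (All.tabulate (∈-support⁻ spokes)))
  count : length rs ≡ ⌊ degree G h /2⌋
  count = begin
    length rs                                         ≡⟨ len ⟩
    length (pairUp (G ─ h) connect (support spokes))  ≡⟨ length-pairUp (G ─ h) connect (support spokes) ⟩
    ⌊ length (support spokes) /2⌋                     ≡⟨ cong ⌊_/2⌋ (length-support spokes) ⟩
    ⌊ ∣ tabulate spokes ∣ /2⌋                         ≡⟨ cong ⌊_/2⌋ (∣tabulate∣-punchIn (adj G h) h (adj-irrefl G h)) ⟩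
    ⌊ degree G h /2⌋                                  ∎
    where open ≡-Reasoning

theorem10 : ∀ {m} (n : ℕ) (G : Graph (suc m)) (h : Fin (suc m)) →
    IsApexTree n G h → IsMaxFrustrationIndex G ⌊ n /2⌋
theorem10 {m} n G h apex with refl ← IsApexTree.degree-apex apex =
  attained , λ where
    -- Any frustration index is at most the size of the deletion found for its signature.
    j (σ , _ , minimal) → let F , F⊆G , balanced , small = small-deletion G h tree σ in
      ℕ.≤-trans (minimal (size F) (F , (λ {u} {v} → F⊆G {u} {v}) , refl , balanced)) small
  where
  open IsApexTree apex using (tree)
  attained : ∃ λ (σ : Signature G) → IsFrustrationIndex σ ⌊ degree G h /2⌋
  attained =
    let σ , large = stubborn-signature G h (proj₂ (proj₁ tree))
        F , F⊆G , balanced , small = small-deletion G h tree σ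
    -- The lower bound applied to the small deletion itself forces its size to be exactly half the
    -- degree, rounded down.
    in σ , (F , (λ {u} {v} → F⊆G {u} {v}) , ℕ.≤-antisym small (large F balanced) , balanced)
         , λ { j (F , _ , refl , balanced) → large F balanced }
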